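{- Let $X$ be a finite set. Two operations $\ast,\star\in\mathcal{M}(X)$ are $\mathcal{L}$-equivalent if and only if $im(T_\ast)=im(T_\star)$ and $diag(T_\ast)=diag(T_\star)$.
   Context: $\mathcal{M}(X)=X^{X\times X}$ is the set of all binary operations on $X$, a monoid under $\triangleright$ defined by $a(\circ\triangleright\ast)b=(a\circ b)\ast(b\circ a)$ for all $a,b\in X$, with identity $a\circ_{lz}b=a$. The left Green's relation $\mathcal{L}$: $\ast\,\mathcal{L}\,\star$ iff $\mathcal{M}(X)\ast=\mathcal{M}(X)\star$, where $\mathcal{M}(X)\ast=\{\circ\triangleright\ast : \circ\in\mathcal{M}(X)\}$. The pairmorph transformation induced by $\ast$ is $T_\ast:X\times X\to X\times X$, $T_\ast(a,b)=(a\ast b,b\ast a)$. With $\Delta(X)=\{(x,x):x\in X\}$, $im(T_\ast)=T_\ast(X\times X)$ and $diag(T_\ast)=T_\ast(\Delta(X))$. -}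

module Defs where

open import Algebra.Bundles using (Monoid)
open import Algebra.Core using (Op₂)
open import Data.Fin.Base using (Fin)
open import Data.Nat.Base using (ℕ)
open import Data.Product.Base using (_×_; _,_; ∃-syntax)
open import Function.Bundles using (_↔_)
open import Level using (Level; _⊔_)
open import Relation.Binary.Core using (Rel)
open import Relation.Binary.PropositionalEquality
  using (_≡_; refl; sym; trans; cong₂)
open import Relation.Unary using (Pred; U; _∈_; _≐_)

private
  variable
    a b c ℓ : Level

Finite : Set a → Set a
Finite X = ∃[ n ] (X ↔ Fin n)

module Green (M : Monoid c ℓ) where
  open Monoid M

  LeftIdeal : Carrier → Pred Carrier (c ⊔ ℓ)
  LeftIdeal y z = ∃[ x ] (x ∙ y ≈ z)

  infix 4 _𝓛_

  _𝓛_ : Rel Carrier (c ⊔ ℓ)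
  x 𝓛 y = LeftIdeal x ≐ LeftIdeal y

infixl 7 _▷_

_▷_ : {X : Set a} → Op₂ X → Op₂ X → Op₂ X
(_∘_ ▷ _*_) a b = (a ∘ b) * (b ∘ a)

lz : {X : Set a} → Op₂ X
lz a b = a

-- Operations are compared pointwise, since function extensionality is not
-- available.
𝓜 : Set a → Monoid a a
𝓜 X = record
  { Carrier  = Op₂ X
  ; _≈_      = λ _∘_ _*_ → ∀ x y → x ∘ y ≡ x * y
  ; _∙_      = _▷_
  ; ε        = lz
  ; isMonoid = record
    { isSemigroup = record
      { isMagma = record
        { isEquivalence = record
          { refl  = λ _ _ → refl
          ; sym   = λ p x y → sym (p x y)
          ; trans = λ p q x y → trans (p x y) (q x y)
          }
        ; ∙-cong = λ {_} {_} {_} {_*′_} p q x y →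
            trans (q _ _) (cong₂ _*′_ (p x y) (p y x))
        }
      ; assoc = λ _ _ _ _ _ → refl
      }
    ; identity = (λ _ _ _ → refl) , (λ _ _ _ → refl)
    }
  }

T : {X : Set a} → Op₂ X → X × X → X × X
T _*_ (a , b) = (a * b) , (b * a)

Image : {A : Set a} {B : Set b} → (A → B) → Pred A ℓ → Pred B (a ⊔ b ⊔ ℓ)
Image f P y = ∃[ x ] (x ∈ P × f x ≡ y)

Δ : (X : Set a) → Pred (X × X) a
Δ X p = ∃[ x ] ((x , x) ≡ p)

im : {X : Set a} → (X × X → X × X) → Pred (X × X) a
im f = Image f U

diag : {X : Set a} → (X × X → X × X) → Pred (X × X) a
diag {X = X} f = Image f (Δ X)

{-# OPTIONS --safe #-}

-- Since T (∘ ▷ ∗) = T ∗ ∘ T ∘, membership of ⋆ in the left ideal of ∗ means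
-- that T ⋆ factors through T ∗ by some T ∘.  The maps T ∘ are exactly those
-- commuting with the coordinate swap, so a factor may be chosen freely on one
-- point of each swap orbit, except that diagonal pairs must go to diagonal
-- pairs.  Hence such a factor exists as soon as im and diag of T ⋆ are
-- contained in those of T ∗.
module Submission where

open import Defs
open import Algebra.Bundles using (Monoid)
open import Algebra.Core using (Op₂)
open import Data.Empty using (⊥-elim)
open import Data.Fin.Base using (Fin)
open import Data.Fin.Properties using (<-cmp)
open import Data.Product.Base using (_×_; _,_; proj₁; proj₂)
open import Function.Bundles using (_⇔_; mk⇔; _↣_; Injection)
open import Function.Properties.Inverse using (↔⇒↣)
open import Level using (Level)
open import Relation.Binary.Definitions using (tri<; tri≈; tri>)
open import Relation.Binary.PropositionalEquality
  using (_≡_; refl; sym; cong; cong₂)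
open import Relation.Unary using (_∈_; _⊆_; _≐_)

private
  variable
    a c ℓ : Level

module LeftIdealProperties (M : Monoid c ℓ) where
  open Monoid M using (_∙_; ε; identityˡ; assoc; ∙-congˡ)
    renaming (trans to ≈-trans)
  open Green M

  generator∈LeftIdeal : ∀ x → x ∈ LeftIdeal x
  generator∈LeftIdeal x = ε , identityˡ x

  -- Reduces comparing principal left ideals to membership of a generator.
  LeftIdeal-⊆ : ∀ x y → y ∈ LeftIdeal x → LeftIdeal y ⊆ LeftIdeal x
  LeftIdeal-⊆ x _ (w , wx≈y) (v , vy≈z) =
    v ∙ w , ≈-trans (assoc v w x) (≈-trans (∙-congˡ wx≈y) vy≈z)

module _ {X : Set a} {_*_ _⋆_ : Op₂ X} where
  open Green (𝓜 X)

  LeftIdeal⇒im-⊆ : _⋆_ ∈ LeftIdeal _*_ → im (T _⋆_) ⊆ im (T _*_)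
  LeftIdeal⇒im-⊆ (_∘_ , eq) ((x , y) , _ , refl) =
    T _∘_ (x , y) , _ , cong₂ _,_ (eq x y) (eq y x)

  -- `T _∘_` maps `Δ X` into itself, so the factorisation restricts to the diagonal.
  LeftIdeal⇒diag-⊆ : _⋆_ ∈ LeftIdeal _*_ → diag (T _⋆_) ⊆ diag (T _*_)
  LeftIdeal⇒diag-⊆ (_∘_ , eq) (_ , (x , refl) , refl) =
    T _∘_ (x , x) , (x ∘ x , refl) , cong₂ _,_ (eq x x) (eq x x)

  -- The order on Fin n selects one pair from each orbit {(x , y) , (y , x)}.
  im-diag-⊆⇒LeftIdeal : ∀ {n} → X ↣ Fin n →
    im (T _⋆_) ⊆ im (T _*_) → diag (T _⋆_) ⊆ diag (T _*_) →
    _⋆_ ∈ LeftIdeal _*_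
  im-diag-⊆⇒LeftIdeal X↣Fin im⊆ diag⊆ = _∘_ , ∘▷*≈⋆
    where
    open Injection X↣Fin using (to; injective)

    pre : ∀ x y → T _⋆_ (x , y) ∈ im (T _*_)
    pre x y = im⊆ ((x , y) , _ , refl)

    preΔ : ∀ x → T _⋆_ (x , x) ∈ diag (T _*_)
    preΔ x = diag⊆ (_ , (x , refl) , refl)

    -- Taken from `preΔ` because a preimage given by `im⊆` may have distinct coordinates, while
    -- `x ∘ x` has to serve as both arguments of `_*_`.
    root : X → X
    root x = proj₁ (proj₁ (proj₂ (preΔ x)))

    root-* : ∀ x → root x * root x ≡ x ⋆ x
    root-* x with _ , (_ , refl) , eq ← preΔ x = cong proj₁ eq

    -- For `x` above `y` the preimage chosen for `(y , x)` is read backwards, which makes `T _∘_`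
    -- commute with the swap.
    _∘_ : Op₂ X
    x ∘ y with <-cmp (to x) (to y)
    ... | tri< _ _ _ = proj₁ (proj₁ (pre x y))
    ... | tri≈ _ _ _ = root x
    ... | tri> _ _ _ = proj₂ (proj₁ (pre y x))

    ∘▷*≈⋆ : ∀ x y → (x ∘ y) * (y ∘ x) ≡ x ⋆ y
    ∘▷*≈⋆ x y with <-cmp (to x) (to y) | <-cmp (to y) (to x)
    -- The two coordinates of a single equation of pairs settle the two orders.
    ... | tri< _ _ _   | tri> _ _ _   = cong proj₁ (proj₂ (proj₂ (pre x y)))
    ... | tri> _ _ _   | tri< _ _ _   = cong proj₂ (proj₂ (proj₂ (pre y x)))
    ... | tri≈ _ x≈y _ | tri≈ _ _ _   with refl ← injective x≈y = root-* x
    -- The two comparisons are split independently; the six remaining combinations are inconsistent.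
    ... | tri< _ _ y≮x | tri< y<x _ _ = ⊥-elim (y≮x y<x)
    ... | tri< _ x≉y _ | tri≈ _ y≈x _ = ⊥-elim (x≉y (sym y≈x))
    ... | tri≈ _ _ y≮x | tri< y<x _ _ = ⊥-elim (y≮x y<x)
    ... | tri≈ x≮y _ _ | tri> _ _ x<y = ⊥-elim (x≮y x<y)
    ... | tri> _ x≉y _ | tri≈ _ y≈x _ = ⊥-elim (x≉y (sym y≈x))
    ... | tri> x≮y _ _ | tri> _ _ x<y = ⊥-elim (x≮y x<y)

corollary5 : {a : Level} (X : Set a) → Finite X → (_*_ _⋆_ : Op₂ X) →
    Green._𝓛_ (𝓜 X) _*_ _⋆_ ⇔ (im (T _*_) ≐ im (T _⋆_) × diag (T _*_) ≐ diag (T _⋆_))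
corollary5 X (_ , X↔Fin) _*_ _⋆_ = mk⇔
  (λ (*⊆⋆ , ⋆⊆*) →
    let *∈ = *⊆⋆ (generator∈LeftIdeal _*_)
        ⋆∈ = ⋆⊆* (generator∈LeftIdeal _⋆_)
    in (LeftIdeal⇒im-⊆ *∈ , LeftIdeal⇒im-⊆ ⋆∈)
     , (LeftIdeal⇒diag-⊆ *∈ , LeftIdeal⇒diag-⊆ ⋆∈))
  (λ ((im⊆ , im⊇) , (diag⊆ , diag⊇)) →
      LeftIdeal-⊆ _⋆_ _*_ (im-diag-⊆⇒LeftIdeal X↣Fin im⊆ diag⊆)
    , LeftIdeal-⊆ _*_ _⋆_ (im-diag-⊆⇒LeftIdeal X↣Fin im⊇ diag⊇))
  where
  open LeftIdealProperties (𝓜 X)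
  X↣Fin = ↔⇒↣ X↔Fin
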